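{- Let $V$ be a finite set and let $k$ be a positive integer. Let $\mathcal{F}\subseteq 2^V$ be the complement of a $k$-hierarchical lattice, and let $f:2^V\to\mathbb{Z}$ be a submodular function. Let $X^*\in\mathcal{F}$ be a minimal minimizer of $f$ over $\mathcal{F}$. Then there exist $S,T\subseteq V$ with $S\cap T=\emptyset$ and $\max\{|S|,|T|\}\le k$ such that $X^*$ is the unique minimal minimizer of $f$ over the lattice $[S,T]$.
   Context: A set function $f:2^V\to\mathbb{Z}$ is submodular if $f(X)+f(Y)\ge f(X\cup Y)+f(X\cap Y)$ for all $X,Y\subseteq V$. A family $\mathcal{H}\subseteq 2^V$ is a $k$-hierarchical lattice if there exists a chain of families $\emptyset=\mathcal{H}_0\subseteq\mathcal{H}_1\subseteq\cdots\subseteq\mathcal{H}_k=\mathcal{H}$ (where $\mathcal{H}_0$ is the empty family) such that for all $i=1,\ldots,k$ and all $X,Y\in\mathcal{H}_i\setminus\mathcal{H}_{i-1}$, either both $X\cup Y$ and $X\cap Y$ belong to $\mathcal{H}_i\setminus\mathcal{H}_{i-1}$, or at least one of $X\cup Y$, $X\cap Y$ belongs to $\mathcal{H}_{i-1}$. A family $\mathcal{F}\subseteq 2^V$ is the complement of a $k$-hierarchical lattice if $2^V\setminus\mathcal{F}$ is a $k$-hierarchical lattice. For disjoint $S,T\subseteq V$, $[S,T]:=\{X\subseteq V\mid S\subseteq X\subseteq V\setminus T\}$. A family of sets is called a lattice if it is closed under union and intersection of two members. A minimizer of $f$ over a family $\mathcal{G}\subseteq 2^V$ is a set $X\in\mathcal{G}$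 with $f(X)\le f(Y)$ for all $Y\in\mathcal{G}$; it is a minimal minimizer over $\mathcal{G}$ if no proper subset of it is a minimizer of $f$ over $\mathcal{G}$ (minimality with respect to inclusion). -}

module Defs where

open import Level using (Level) renaming (suc to lsuc)
open import Data.Nat.Base using (ℕ; suc)
open import Data.Integer.Base using (ℤ; _+_; _≤_; _≥_)
open import Data.Fin.Base using (Fin; zero; suc; inject₁; fromℕ)
open import Data.Fin.Subset using (Subset; _∪_; _∩_; _⊆_; _⊂_; ∁)
open import Data.Product.Base using (_×_; ∃)
open import Data.Sum.Base using (_⊎_)
open import Relation.Nullary.Negation.Core using (¬_)
open import Relation.Binary.PropositionalEquality.Core using (_≡_)
import Relation.Unary as U

-- The finite ground set V is Fin n, so Subset n is its power set.  A family
-- of subsets of V is an arbitrary predicate; it need not be decidable.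
Family : ℕ → (ℓ : Level) → Set (lsuc ℓ)
Family n ℓ = U.Pred (Subset n) ℓ

Submodular : {n : ℕ} → (Subset n → ℤ) → Set
Submodular f = ∀ X Y → f X + f Y ≥ f (X ∪ Y) + f (X ∩ Y)

-- chain i is the i-th family for i = 0, …, k.  The step indexed by i : Fin k
-- goes from position toℕ i (inject₁ i) to position 1 + toℕ i (suc i).
record IsHierarchicalChain {n : ℕ} {ℓ : Level} (k : ℕ) (ℋ : Family n ℓ)
                           (chain : Fin (suc k) → Family n ℓ) : Set ℓ where
  layer : Fin k → Family n ℓ
  layer i = chain (suc i) U.∖ chain (inject₁ i)

  field
    starts-empty : chain zero U.≐ U.∅
    ends-at      : chain (fromℕ k) U.≐ ℋ
    increasing   : ∀ i → chain (inject₁ i) U.⊆ chain (suc i)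
    hierarchical : ∀ i X Y → X U.∈ layer i → Y U.∈ layer i →
                   (X ∪ Y U.∈ layer i × X ∩ Y U.∈ layer i)
                   ⊎ (X ∪ Y U.∈ chain (inject₁ i) ⊎ X ∩ Y U.∈ chain (inject₁ i))

IsHierarchicalLattice : {n : ℕ} {ℓ : Level} → ℕ → Family n ℓ → Set (lsuc ℓ)
IsHierarchicalLattice k ℋ = ∃ λ chain → IsHierarchicalChain k ℋ chain

IsComplementOfHierarchicalLattice : {n : ℕ} {ℓ : Level} → ℕ → Family n ℓ → Set (lsuc ℓ)
IsComplementOfHierarchicalLattice k ℱ = IsHierarchicalLattice k (U.∁ ℱ)

[_,_] : {n : ℕ} → Subset n → Subset n → Family n Level.zero
[ S , T ] X = S ⊆ X × X ⊆ ∁ T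

IsMinimizer : {n : ℕ} {ℓ : Level} → (Subset n → ℤ) → Family n ℓ → Subset n → Set ℓ
IsMinimizer f 𝒢 X = X U.∈ 𝒢 × (∀ Y → Y U.∈ 𝒢 → f X ≤ f Y)

IsMinimalMinimizer : {n : ℕ} {ℓ : Level} → (Subset n → ℤ) → Family n ℓ → Subset n → Set ℓ
IsMinimalMinimizer f 𝒢 X =
  IsMinimizer f 𝒢 X × (∀ Y → Y ⊂ X → ¬ IsMinimizer f 𝒢 Y)

IsUniqueMinimalMinimizer : {n : ℕ} {ℓ : Level} → (Subset n → ℤ) → Family n ℓ → Subset n → Set ℓ
IsUniqueMinimalMinimizer f 𝒢 X =
  IsMinimalMinimizer f 𝒢 X × (∀ Y → IsMinimalMinimizer f 𝒢 Y → Y ≡ X)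

{-# OPTIONS --safe #-}
module Submission where

-- Claim: for every i ≤ k there are S ⊆ X* and T ⊆ V ∖ X* of size at most i such
-- that [S , T] contains no member of ℋᵢ.  For i = 0 take S = T = ∅.  Given such
-- S , T for ℋᵢ, no union or intersection of sets in [S , T] lies in ℋᵢ, so
-- ℋᵢ₊₁ ∩ [S , T] is a lattice.  If it met [S ∪ {s} , T ∪ {t}] for all s ∈ X* and
-- t ∉ X*, then taking unions over s and intersections over t would produce X*
-- itself, which is not in ℋᵢ₊₁; so some s , t extend S , T.  For i = k the
-- interval [S , T] lies in ℱ, hence X* is a minimal minimizer over it, and
-- submodularity makes it the only one.
--
-- The families are not decidable, so S and T are found under a double negation,
-- which the decidability of the conclusion removes.

open import Defs
open import Level using (Level)
open import Data.Nat.Base using (ℕ; suc; NonZero; _≤_; _⊔_; z≤n; s≤s)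
import Data.Nat.Base as ℕ
import Data.Nat.Properties as ℕ
open import Data.Integer.Base using (ℤ)
import Data.Integer.Base as ℤ
import Data.Integer.Properties as ℤ
open import Data.Fin.Base using (Fin; zero; suc; toℕ; inject₁; fromℕ)
open import Data.Fin.Properties using (toℕ-inject₁; toℕ-fromℕ)
open import Data.Fin.Induction using (<-weakInduction)
open import Data.Fin.Subset
  using (Subset; inside; outside; _∪_; _∩_; _∈_; _⊆_; _⊂_; ⊥; ∁; ⁅_⁆; ∣_∣)
open import Data.Fin.Subset.Properties
open import Data.Product.Base using (_×_; _,_; ∃; ∃₂; proj₁; proj₂)
open import Data.Sum.Base using (inj₁; inj₂; [_,_]′)
open import Data.Vec.Base using ([]; _∷_; here; there)
open import Function.Base using (_∘_)
open import Relation.Binary.PropositionalEquality.Core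
  using (_≡_; sym; trans; subst)
open import Relation.Nullary.Decidable
  using (Dec; ¬?; _×-dec_; _→-dec_; map′; decidable-stable)
open import Relation.Nullary.Negation using (¬_; contradiction; ¬¬-map)
import Relation.Unary as U

private
  variable
    ℓ ℓ′ : Level
    n : ℕ
    𝒢 : Family n ℓ
    S T S₁ S₂ T₁ T₂ X Y : Subset n

UnionClosed IntersectionClosed : Family n ℓ → Set ℓ
UnionClosed        𝒢 = ∀ {X Y} → 𝒢 X → 𝒢 Y → 𝒢 (X ∪ Y)
IntersectionClosed 𝒢 = ∀ {X Y} → 𝒢 X → 𝒢 Y → 𝒢 (X ∩ Y)

∪-⊆ : X ⊆ S → Y ⊆ S → X ∪ Y ⊆ S
∪-⊆ {X = X} {Y = Y} X⊆S Y⊆S = [ X⊆S , Y⊆S ]′ ∘ x∈p∪q⁻ X Y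

∩-⊇ : S ⊆ X → S ⊆ Y → S ⊆ X ∩ Y
∩-⊇ S⊆X S⊆Y x∈S = x∈p∩q⁺ (S⊆X x∈S , S⊆Y x∈S)

⊆∁-sym : X ⊆ ∁ Y → Y ⊆ ∁ X
⊆∁-sym X⊆∁Y y∈Y = x∉p⇒x∈∁p λ y∈X → x∈∁p⇒x∉p (X⊆∁Y y∈X) y∈Y

⊆∁⇒∩≡⊥ : X ⊆ ∁ Y → X ∩ Y ≡ ⊥
⊆∁⇒∩≡⊥ {X = X} {Y} X⊆∁Y = Empty-unique λ (_ , x∈X∩Y) →
  let x∈X , x∈Y = x∈p∩q⁻ X Y x∈X∩Y in x∈∁p⇒x∉p (X⊆∁Y x∈X) x∈Y

⁅⁆-⊆ : ∀ {x} → x ∈ X → ⁅ x ⁆ ⊆ X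
⁅⁆-⊆ {X = X} x∈X y∈⁅x⁆ = subst (_∈ X) (sym (x∈⁅y⁆⇒x≡y _ y∈⁅x⁆)) x∈X

⊆∧⊄⇒≡ : X ⊆ Y → ¬ (X ⊂ Y) → X ≡ Y
⊆∧⊄⇒≡ {X = X} X⊆Y X⊄Y = ⊆-antisym X⊆Y λ {x} x∈Y →
  decidable-stable (x ∈? X) λ x∉X → X⊄Y (X⊆Y , x , x∈Y , x∉X)

∣p∪q∣≤∣p∣+∣q∣ : ∀ (p q : Subset n) → ∣ p ∪ q ∣ ≤ ∣ p ∣ ℕ.+ ∣ q ∣
∣p∪q∣≤∣p∣+∣q∣ []            []            = z≤n
∣p∪q∣≤∣p∣+∣q∣ (outside ∷ p) (outside ∷ q) = ∣p∪q∣≤∣p∣+∣q∣ p q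
∣p∪q∣≤∣p∣+∣q∣ (outside ∷ p) (inside  ∷ q) =
  subst (suc ∣ p ∪ q ∣ ≤_) (sym (ℕ.+-suc ∣ p ∣ ∣ q ∣)) (s≤s (∣p∪q∣≤∣p∣+∣q∣ p q))
∣p∪q∣≤∣p∣+∣q∣ (inside  ∷ p) (outside ∷ q) = s≤s (∣p∪q∣≤∣p∣+∣q∣ p q)
∣p∪q∣≤∣p∣+∣q∣ (inside  ∷ p) (inside  ∷ q) =
  s≤s (ℕ.≤-trans (∣p∪q∣≤∣p∣+∣q∣ p q) (ℕ.+-monoʳ-≤ ∣ p ∣ (ℕ.n≤1+n ∣ q ∣)))

∪-induction : (P : Family n ℓ) → P ⊥ → UnionClosed P →
              ∀ X → (∀ {x} → x ∈ X → P ⁅ x ⁆) → P X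
∪-induction P P⊥ P∪ []      P⁅⁆ = P⊥
∪-induction P P⊥ P∪ (b ∷ X) P⁅⁆
  with P-outside ← ∪-induction (P ∘ (outside ∷_)) P⊥ P∪ X (P⁅⁆ ∘ there) | b
... | outside = P-outside
-- `⁅ zero ⁆ ∪ (outside ∷ X)` computes to `inside ∷ (⊥ ∪ X)`.
... | inside  = subst (P ∘ (inside ∷_)) (∪-identityˡ X) (P∪ (P⁅⁆ here) P-outside)

allSubset? : {P : Family n ℓ} → U.Decidable P → Dec (∀ X → P X)
allSubset? P? = map′ (λ ¬∃¬P X → decidable-stable (P? X) λ ¬PX → ¬∃¬P (X , ¬PX))
                     (λ ∀P (X , ¬PX) → ¬PX (∀P X))
                     (¬? (anySubset? (¬? ∘ P?)))

[,]-∪ : UnionClosed [ S , T ]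
[,]-∪ {Y = Y} (S⊆X , X⊆∁T) (_ , Y⊆∁T) = (p⊆p∪q Y ∘ S⊆X) , ∪-⊆ X⊆∁T Y⊆∁T

[,]-∩ : IntersectionClosed [ S , T ]
[,]-∩ {X = X} {Y} (S⊆X , X⊆∁T) (S⊆Y , _) = ∩-⊇ S⊆X S⊆Y , X⊆∁T ∘ p∩q⊆p X Y

[∪,∪]⁺ : [ S₁ , T₁ ] X → [ S₂ , T₂ ] X → [ S₁ ∪ S₂ , T₁ ∪ T₂ ] X
[∪,∪]⁺ (S₁⊆X , X⊆∁T₁) (S₂⊆X , X⊆∁T₂) =
  ∪-⊆ S₁⊆X S₂⊆X , ⊆∁-sym (∪-⊆ (⊆∁-sym X⊆∁T₁) (⊆∁-sym X⊆∁T₂))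

[∪,∪]⁻ : [ S₁ ∪ S₂ , T₁ ∪ T₂ ] X → [ S₁ , T₁ ] X × [ S₂ , T₂ ] X
[∪,∪]⁻ {S₁ = S₁} {S₂ = S₂} {T₁ = T₁} {T₂ = T₂} (S⊆X , X⊆∁T) =
    (S⊆X ∘ p⊆p∪q S₂ , p⊆q⇒∁p⊇∁q (p⊆p∪q T₂) ∘ X⊆∁T)
  , (S⊆X ∘ q⊆p∪q S₁ S₂ , p⊆q⇒∁p⊇∁q (q⊆p∪q T₁ T₂) ∘ X⊆∁T)

Hits : Family n ℓ → Subset n → Subset n → Set ℓ
Hits 𝒢 S T = ∃ λ Y → 𝒢 Y × [ S , T ] Y

-- The common upper bound survives a union of witnesses, while the lower bounds add up; `hits-∩` is
-- dual.
hits-∪ : UnionClosed 𝒢 → Hits 𝒢 S₁ T → Hits 𝒢 S₂ T → Hits 𝒢 (S₁ ∪ S₂) T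
hits-∪ 𝒢∪ (Y , Y∈𝒢 , S₁⊆Y , Y⊆∁T) (Z , Z∈𝒢 , S₂⊆Z , Z⊆∁T) =
  Y ∪ Z , 𝒢∪ Y∈𝒢 Z∈𝒢 , ∪-⊆ (p⊆p∪q Z ∘ S₁⊆Y) (q⊆p∪q Y Z ∘ S₂⊆Z) , ∪-⊆ Y⊆∁T Z⊆∁T

hits-∩ : IntersectionClosed 𝒢 → Hits 𝒢 S T₁ → Hits 𝒢 S T₂ → Hits 𝒢 S (T₁ ∪ T₂)
hits-∩ 𝒢∩ (Y , Y∈𝒢 , S⊆Y , Y⊆∁T₁) (Z , Z∈𝒢 , S⊆Z , Z⊆∁T₂) =
  Y ∩ Z , 𝒢∩ Y∈𝒢 Z∈𝒢 , ∩-⊇ S⊆Y S⊆Z ,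
  ⊆∁-sym (∪-⊆ (⊆∁-sym (Y⊆∁T₁ ∘ p∩q⊆p Y Z)) (⊆∁-sym (Z⊆∁T₂ ∘ p∩q⊆q Y Z)))

-- The invariant of the induction along the chain. Membership of `X` in `[ S , T ]` already encodes
-- that `S` and `T` are disjoint.
Separated : Family n ℓ → ℕ → Subset n → Set ℓ
Separated 𝒢 m X = ∃₂ λ S T → ∣ S ∣ ≤ m × ∣ T ∣ ≤ m × [ S , T ] X × ¬ Hits 𝒢 S T

-- If every interval around `X` with ends of size at most 1 met `𝒢`, then so would `[ X , ∁ X ]`,
-- whose only member is `X`. Size 0 is allowed so that `X` may be empty or all of the ground set.
lattice-separated : ∀ {n} {𝒢 : Family n ℓ} {X} → UnionClosed 𝒢 → IntersectionClosed 𝒢 →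
                    ¬ 𝒢 X → ¬ ¬ Separated 𝒢 1 X
lattice-separated {n = n} {𝒢 = 𝒢} {X = X} 𝒢∪ 𝒢∩ X∉𝒢 ¬sep = hits-X-∁X λ where
    (Y , Y∈𝒢 , X⊆Y , Y⊆∁∁X) →
      X∉𝒢 (subst 𝒢 (⊆-antisym (λ y∈Y → x∉∁p⇒x∈p (x∈∁p⇒x∉p (Y⊆∁∁X y∈Y))) X⊆Y) Y∈𝒢)
  where
  ∣⊥∣≤1 : ∣ ⊥ {n = n} ∣ ≤ 1
  ∣⊥∣≤1 = ℕ.≤-trans (ℕ.≤-reflexive (∣⊥∣≡0 n)) z≤n

  ∣⁅⁆∣≤1 : ∀ x → ∣ ⁅_⁆ {n} x ∣ ≤ 1
  ∣⁅⁆∣≤1 = ℕ.≤-reflexive ∘ ∣⁅x⁆∣≡1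

  hits-X : ∣ T ∣ ≤ 1 → X ⊆ ∁ T → ¬ ¬ Hits 𝒢 X T
  hits-X {T = T} ∣T∣≤1 X⊆∁T = ∪-induction (λ S → ¬ ¬ Hits 𝒢 S T)
    (λ ¬hit → ¬sep (_ , _ , ∣⊥∣≤1 , ∣T∣≤1 , (⊥⊆ , X⊆∁T) , ¬hit))
    (λ hit₁ hit₂ ¬hit → hit₁ λ h₁ → hit₂ λ h₂ → ¬hit (hits-∪ 𝒢∪ h₁ h₂))
    X
    (λ {x} x∈X ¬hit → ¬sep (_ , _ , ∣⁅⁆∣≤1 x , ∣T∣≤1 , (⁅⁆-⊆ x∈X , X⊆∁T) , ¬hit))

  -- Intersecting members of `𝒢` unites the sets they avoid, so `∪-induction` on `∁ X` serves here
  -- too.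
  hits-X-∁X : ¬ ¬ Hits 𝒢 X (∁ X)
  hits-X-∁X = ∪-induction (λ T → ¬ ¬ Hits 𝒢 X T)
    (hits-X ∣⊥∣≤1 (⊆∁-sym ⊥⊆))
    (λ hit₁ hit₂ ¬hit → hit₁ λ h₁ → hit₂ λ h₂ → ¬hit (hits-∩ 𝒢∩ h₁ h₂))
    (∁ X)
    (λ {x} x∈∁X → hits-X (∣⁅⁆∣≤1 x) (⊆∁-sym (⁅⁆-⊆ x∈∁X)))

chain-separated : ∀ {n k X} {ℋ : Family n ℓ} {chain : Fin (suc k) → Family n ℓ} →
                  IsHierarchicalChain k ℋ chain →
                  ∀ i → ¬ chain i X → ¬ ¬ Separated (chain i) (toℕ i) X
chain-separated {n = n} {X = X} {chain = chain} hc =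
    <-weakInduction (λ i → ¬ chain i X → ¬ ¬ Separated (chain i) (toℕ i) X) base step
  where
  open IsHierarchicalChain hc

  base : ¬ chain zero X → ¬ ¬ Separated (chain zero) 0 X
  base _ ¬sep = ¬sep
    ( ⊥ , ⊥ , ℕ.≤-reflexive (∣⊥∣≡0 n) , ℕ.≤-reflexive (∣⊥∣≡0 n) , (⊥⊆ , ⊆∁-sym ⊥⊆)
    , λ (_ , Y∈ℋ₀ , _) → proj₁ starts-empty Y∈ℋ₀ )

  step : ∀ i → (¬ chain (inject₁ i) X → ¬ ¬ Separated (chain (inject₁ i)) (toℕ (inject₁ i)) X) →
         ¬ chain (suc i) X → ¬ ¬ Separated (chain (suc i)) (suc (toℕ i)) X
  step i ih X∉ ¬sep = ih (X∉ ∘ increasing i) λ where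
      (S , T , ∣S∣≤ , ∣T∣≤ , X∈[S,T] , ¬hit) →
        -- The lattice is `chain (suc i)` cut down to `[ S , T ]`; separating `X` from it costs one
        -- more element on each side.
        lattice-separated (∪-closed ¬hit) (∩-closed ¬hit) (X∉ ∘ proj₁) λ where
          (S′ , T′ , ∣S′∣≤1 , ∣T′∣≤1 , X∈[S′,T′] , ¬hit′) → ¬sep
            ( S′ ∪ S , T′ ∪ T , bound S′ S ∣S′∣≤1 ∣S∣≤ , bound T′ T ∣T′∣≤1 ∣T∣≤
            , [∪,∪]⁺ X∈[S′,T′] X∈[S,T]
            , λ (Y , Y∈ , Y∈[,]) → let Y∈[S′,T′] , Y∈[S,T] = [∪,∪]⁻ Y∈[,] in
                ¬hit′ (Y , (Y∈ , Y∈[S,T]) , Y∈[S′,T′]) )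
    where
    bound : ∀ (A B : Subset n) → ∣ A ∣ ≤ 1 → ∣ B ∣ ≤ toℕ (inject₁ i) → ∣ A ∪ B ∣ ≤ suc (toℕ i)
    bound A B ∣A∣≤1 ∣B∣≤ = ℕ.≤-trans (∣p∪q∣≤∣p∣+∣q∣ A B)
      (ℕ.+-mono-≤ ∣A∣≤1 (subst (∣ B ∣ ≤_) (toℕ-inject₁ i) ∣B∣≤))

    module _ {S T : Subset n} (¬hit : ¬ Hits (chain (inject₁ i)) S T) where

      in-layer : ∀ {Y} → chain (suc i) Y → [ S , T ] Y → layer i Y
      in-layer Y∈ Y∈[,] = Y∈ , λ Y∈′ → ¬hit (_ , Y∈′ , Y∈[,])

      ∪∩-closed : ∀ {Y Z} → (chain (suc i) U.∩ [ S , T ]) Y → (chain (suc i) U.∩ [ S , T ]) Z →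
                  chain (suc i) (Y ∪ Z) × chain (suc i) (Y ∩ Z)
      ∪∩-closed {Y} {Z} (Y∈ , Y∈[,]) (Z∈ , Z∈[,])
        with hierarchical i Y Z (in-layer Y∈ Y∈[,]) (in-layer Z∈ Z∈[,])
      ... | inj₁ (∪∈ , ∩∈)   = proj₁ ∪∈ , proj₁ ∩∈
      ... | inj₂ (inj₁ ∪∈ℋᵢ) = contradiction (_ , ∪∈ℋᵢ , [,]-∪ Y∈[,] Z∈[,]) ¬hit
      ... | inj₂ (inj₂ ∩∈ℋᵢ) = contradiction (_ , ∩∈ℋᵢ , [,]-∩ Y∈[,] Z∈[,]) ¬hit

      ∪-closed : UnionClosed (chain (suc i) U.∩ [ S , T ])
      ∪-closed Y∈ Z∈ = proj₁ (∪∩-closed Y∈ Z∈) , [,]-∪ (proj₂ Y∈) (proj₂ Z∈)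

      ∩-closed : IntersectionClosed (chain (suc i) U.∩ [ S , T ])
      ∩-closed Y∈ Z∈ = proj₂ (∪∩-closed Y∈ Z∈) , [,]-∩ (proj₂ Y∈) (proj₂ Z∈)

module _ (f : Subset n → ℤ) where

  isMinimizer? : U.Decidable 𝒢 → U.Decidable (IsMinimizer f 𝒢)
  isMinimizer? 𝒢? X = 𝒢? X ×-dec allSubset? λ Y → 𝒢? Y →-dec f X ℤ.≤? f Y

  isMinimalMinimizer? : U.Decidable 𝒢 → U.Decidable (IsMinimalMinimizer f 𝒢)
  isMinimalMinimizer? 𝒢? X =
    isMinimizer? 𝒢? X ×-dec allSubset? λ Y → Y ⊂? X →-dec ¬? (isMinimizer? 𝒢? Y)

  -- As `f X ≤ f (X ∪ Y)`, submodularity leaves `f (X ∩ Y) ≤ f Y`.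
  minimizer-∩ : Submodular f → UnionClosed 𝒢 → IntersectionClosed 𝒢 →
                IsMinimizer f 𝒢 X → IsMinimizer f 𝒢 Y → IsMinimizer f 𝒢 (X ∩ Y)
  minimizer-∩ {X = X} {Y = Y} sub 𝒢∪ 𝒢∩ (X∈𝒢 , X-min) (Y∈𝒢 , Y-min) =
      𝒢∩ X∈𝒢 Y∈𝒢 , λ Z Z∈𝒢 → ℤ.≤-trans f∩≤fY (Y-min Z Z∈𝒢)
    where
    f∩≤fY : f (X ∩ Y) ℤ.≤ f Y
    f∩≤fY = ℤ.≮⇒≥ λ fY<f∩ → ℤ.<⇒≱
      (ℤ.+-mono-≤-< (X-min (X ∪ Y) (𝒢∪ X∈𝒢 Y∈𝒢)) fY<f∩) (sub X Y)

  -- `X ∩ Y` is again a minimizer, so by minimality it is a proper subset of neither `X` nor `Y`.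
  minimalMinimizer-unique : Submodular f → UnionClosed 𝒢 → IntersectionClosed 𝒢 →
                            IsMinimalMinimizer f 𝒢 X → IsMinimalMinimizer f 𝒢 Y → Y ≡ X
  minimalMinimizer-unique {X = X} {Y = Y} sub 𝒢∪ 𝒢∩ (X-min , X-minimal) (Y-min , Y-minimal) =
    trans (sym (⊆∧⊄⇒≡ (p∩q⊆q X Y) λ ⊂Y → Y-minimal _ ⊂Y ∩-min))
          (⊆∧⊄⇒≡ (p∩q⊆p X Y) λ ⊂X → X-minimal _ ⊂X ∩-min)
    where
    ∩-min : IsMinimizer f _ (X ∩ Y)
    ∩-min = minimizer-∩ sub 𝒢∪ 𝒢∩ X-min Y-min

  -- The inclusion of `𝒢` in `ℱ` is known only up to double negation. That suffices: integer
  -- comparison is decidable, and minimality is a negative statement.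
  minimalMinimizer-restrict : {ℱ : Family n ℓ} {𝒢 : Family n ℓ′} →
    (∀ Y → 𝒢 Y → ¬ ¬ ℱ Y) → 𝒢 X → IsMinimalMinimizer f ℱ X → IsMinimalMinimizer f 𝒢 X
  minimalMinimizer-restrict {X = X} 𝒢⊆ℱ X∈𝒢 ((_ , X-min) , X-minimal) =
      (X∈𝒢 , λ Y Y∈𝒢 → decidable-stable (f X ℤ.≤? f Y) (¬¬-map (X-min Y) (𝒢⊆ℱ Y Y∈𝒢)))
    , λ Y Y⊂X (Y∈𝒢 , Y-min) → 𝒢⊆ℱ Y Y∈𝒢 λ Y∈ℱ →
        -- Since `X` lies in `𝒢`, a minimizer over `𝒢` has value at most `f X`, the minimum over
        -- `ℱ`.
        X-minimal Y Y⊂X (Y∈ℱ , λ Z Z∈ℱ → ℤ.≤-trans (Y-min X X∈𝒢) (X-min Z Z∈ℱ))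

[_,_]? : (S T : Subset n) → U.Decidable [ S , T ]
[ S , T ]? X = S ⊆? X ×-dec X ⊆? ∁ T

theorem2p2 : ∀ {ℓ : Level} (n k : ℕ) .{{_ : NonZero k}}
    (ℱ : Family n ℓ) → IsComplementOfHierarchicalLattice k ℱ →
    (f : Subset n → ℤ) → Submodular f →
    (X* : Subset n) → IsMinimalMinimizer f ℱ X* →
    ∃₂ λ (S T : Subset n) →
      S ∩ T ≡ ⊥ ×
      ∣ S ∣ ⊔ ∣ T ∣ ≤ k ×
      IsUniqueMinimalMinimizer f [ S , T ] X*
theorem2p2 n k ℱ (chain , hc) f sub X* X*-minimal =
  let S , T , size , minimal = decidable-stable witness? (¬¬-map witness separated)
      (S⊆X* , X*⊆∁T) , _ = proj₁ minimal
  in S , T , ⊆∁⇒∩≡⊥ (X*⊆∁T ∘ S⊆X*) , size , minimal ,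
     λ Y → minimalMinimizer-unique f sub [,]-∪ [,]-∩ minimal
  where
  open IsHierarchicalChain hc

  -- Mentions neither `ℱ` nor the chain, so a search over all pairs of subsets decides it;
  -- disjointness and uniqueness follow afterwards.
  Witness : Set
  Witness = ∃₂ λ S T → ∣ S ∣ ⊔ ∣ T ∣ ≤ k × IsMinimalMinimizer f [ S , T ] X*

  witness? : Dec Witness
  witness? = anySubset? λ S → anySubset? λ T →
    ∣ S ∣ ⊔ ∣ T ∣ ℕ.≤? k ×-dec isMinimalMinimizer? f [ S , T ]? X*

  X*∉ℋ : ¬ chain (fromℕ k) X*
  X*∉ℋ X*∈ℋ = proj₁ ends-at X*∈ℋ (proj₁ (proj₁ X*-minimal))

  separated : ¬ ¬ Separated (chain (fromℕ k)) k X*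
  separated = subst (λ m → ¬ ¬ Separated (chain (fromℕ k)) m X*) (toℕ-fromℕ k)
    (chain-separated hc (fromℕ k) X*∉ℋ)

  witness : Separated (chain (fromℕ k)) k X* → Witness
  witness (S , T , ∣S∣≤k , ∣T∣≤k , X*∈[S,T] , ¬hit) =
    S , T , ℕ.⊔-lub ∣S∣≤k ∣T∣≤k , minimalMinimizer-restrict f
      -- The top family is the complement of `ℱ`, so missing it yields `¬ ¬ ℱ Y` only.
      (λ Y Y∈[S,T] Y∉ℱ → ¬hit (Y , proj₂ ends-at Y∉ℱ , Y∈[S,T])) X*∈[S,T] X*-minimal
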